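{- Let $Q=T[H_1,\dots,H_t]$ be a strong semicomplete composition of order $n$, let $k\in\{1,\dots,n\}$, and for each $i\in\{1,\dots,t\}$ let $\ell_{i,k}$ denote the maximum number of vertices of $H_i$ that can be covered by a $k$-path subdigraph in $Q$. Then every maximum $k$-path subdigraph in $Q$ covers exactly $\ell_{i,k}$ vertices of $H_i$ for each $i\in\{1,\dots,t\}$.
   Context: Digraphs are finite, without loops or parallel arcs (2-cycles are allowed); paths are directed, and a single vertex is a path. A digraph is semicomplete if there is at least one arc between every pair of distinct vertices. Let $T$ be a digraph with vertices $u_1,\dots,u_t$ ($t\ge 2$) and let $H_1,\dots,H_t$ be pairwise disjoint nonempty digraphs. The composition $Q=T[H_1,\dots,H_t]$ is the digraph with vertex set $\bigcup_i V(H_i)$ and arc set $\bigcup_{i=1}^t A(H_i)\cup\{xy : x\in V(H_i),\ y\in V(H_p),\ u_iu_p\in A(T)\}$. It is a semicomplete composition if $T$ is semicomplete. A digraph is strong if for every ordered pair of vertices $(x,y)$ there is a directed path from $x$ to $y$. A $k$-path subdigraph of a digraph $D$ is a collection of $k$ pairwise vertex-disjoint paths of $D$. A maximum $k$-path subdigraph is a $k$-path subdigraph covering the maximum number of vertices among all $k$-path subdigraphs of $D$. -}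

module Defs where

open import Data.Fin using (Fin)
open import Data.Fin.Properties using (any?)
open import Data.List using (List; []; length; map; filter; head; last; concat)
open import Data.List.Membership.Propositional using (_∈_)
open import Data.List.Membership.Propositional.Properties using (∈-map⁺; ∈-map⁻; ∈-concat⁺′)
open import Data.List.Relation.Binary.Disjoint.Propositional using (Disjoint)
open import Data.List.Relation.Unary.Linked using (Linked)
open import Data.List.Relation.Unary.Unique.Propositional using (Unique)
open import Data.Maybe using (just)
open import Data.Nat using (ℕ; _≤_)
open import Data.Product using (Σ; ∃-syntax; _×_; _,_; proj₁)
open import Data.Product.Properties using (≡-dec)
open import Data.Sum using (_⊎_)
open import Level using (0ℓ)
open import Relation.Binary using (Rel; Decidable; DecidableEquality)
open import Relation.Binary.PropositionalEquality using (_≡_; _≢_; refl; sym; trans)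
open import Relation.Nullary using (¬_; Dec; yes; no)
import Data.List.Membership.DecPropositional as DecMembership
import Data.List.Relation.Unary.All as All
import Data.List.Relation.Unary.All.Properties as Allₚ
import Data.List.Relation.Unary.AllPairs as AllPairs
import Data.List.Relation.Unary.AllPairs.Properties as AllPairsₚ
import Data.List.Relation.Unary.Unique.Propositional.Properties as Uniqueₚ

-- The arcs form a binary relation, so there are no parallel arcs, while
-- x ⟶ y and y ⟶ x may both hold.  Decidability of equality and of the arc
-- relation, automatic classically for finite digraphs, is part of the data.
record Digraph : Set₁ where
  infix 4 _⟶_ _⟶?_ _≟_
  field
    Vertex   : Set
    _≟_      : DecidableEquality Vertex
    vertices : List Vertex
    complete : ∀ v → v ∈ vertices
    unique   : Unique vertices
    _⟶_      : Rel Vertex 0ℓ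
    _⟶?_     : Decidable _⟶_
    loopless : ∀ v → ¬ (v ⟶ v)

  order : ℕ
  order = length vertices

open Digraph using (Vertex; vertices; order)

Semicomplete : Digraph → Set
Semicomplete D = ∀ x y → x ≢ y → (x ⟶ y) ⊎ (y ⟶ x)
  where open Digraph D using (_⟶_)

record Path (D : Digraph) : Set where
  open Digraph D using (_⟶_)
  field
    verts    : List (Vertex D)
    nonempty : verts ≢ []
    linked   : Linked _⟶_ verts
    distinct : Unique verts

open Path using (verts)

Strong : Digraph → Set
Strong D = ∀ (x y : Vertex D) →
  ∃[ p ] (head (verts {D} p) ≡ just x × last (verts p) ≡ just y)

-- The paths are listed in some order, which affects none of the notions below.
record PathSubdigraph (k : ℕ) (D : Digraph) : Set where
  field
    path     : Fin k → Path D
    disjoint : ∀ {a b} → a ≢ b → Disjoint (verts (path a)) (verts (path b))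

open PathSubdigraph using (path)

module _ {k : ℕ} {D : Digraph} where

  Covers : PathSubdigraph k D → Vertex D → Set
  Covers P v = ∃[ a ] (v ∈ verts (path P a))

  covers? : ∀ P v → Dec (Covers P v)
  covers? P v = any? (λ a → v ∈? verts (path P a))
    where open DecMembership (Digraph._≟_ D) using (_∈?_)

  #covered : PathSubdigraph k D → ℕ
  #covered P = length (filter (covers? P) (vertices D))

  IsMaximum : PathSubdigraph k D → Set
  IsMaximum P = ∀ (P′ : PathSubdigraph k D) → #covered P′ ≤ #covered P

module Composition (T : Digraph) (H : Vertex T → Digraph) where

  private
    module T = Digraph T
    module H i = Digraph (H i)

  CVertex : Set
  CVertex = Σ (Vertex T) (λ i → Vertex (H i))

  data CArc : Rel CVertex 0ℓ where
    inner : ∀ {i x y} → H._⟶_ i x y → CArc (i , x) (i , y)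
    outer : ∀ {i p x y} → i T.⟶ p → CArc (i , x) (p , y)

  fibre : Vertex T → List CVertex
  fibre i = map (i ,_) (vertices (H i))

  fibre-index : ∀ {i v} → v ∈ fibre i → proj₁ v ≡ i
  fibre-index v∈ with ∈-map⁻ _ v∈
  ... | _ , _ , refl = refl

  fibre-disjoint : ∀ {i j} → i ≢ j → Disjoint (fibre i) (fibre j)
  fibre-disjoint i≢j (v∈i , v∈j) = i≢j (trans (sym (fibre-index v∈i)) (fibre-index v∈j))

  cVertices : List CVertex
  cVertices = concat (map fibre (vertices T))

  cComplete : ∀ v → v ∈ cVertices
  cComplete (i , x) =
    ∈-concat⁺′ (∈-map⁺ (i ,_) (H.complete i x)) (∈-map⁺ fibre (T.complete i))

  cUnique : Unique cVertices
  cUnique = Uniqueₚ.concat⁺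
    (Allₚ.map⁺ (All.tabulate (λ {i} _ → Uniqueₚ.map⁺ (λ { refl → refl }) (H.unique i))))
    (AllPairsₚ.map⁺ (AllPairs.map fibre-disjoint T.unique))

  cArc? : Decidable CArc
  cArc? (i , x) (p , y) with i T.⟶? p
  ... | yes ip = yes (outer ip)
  ... | no ¬ip with i T.≟ p
  ...   | no i≢p = no λ { (inner _) → i≢p refl ; (outer ip) → ¬ip ip }
  ...   | yes refl with H._⟶?_ i x y
  ...     | yes xy = yes (inner xy)
  ...     | no ¬xy = no λ { (inner xy) → ¬xy xy ; (outer ip) → ¬ip ip }

  cLoopless : ∀ v → ¬ CArc v v
  cLoopless (i , x) (inner xx) = H.loopless i x xx
  cLoopless (i , x) (outer ii) = T.loopless i ii

  composition : Digraph
  composition = record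
    { Vertex   = CVertex
    ; _≟_      = ≡-dec T._≟_ (λ {i} → H._≟_ i)
    ; vertices = cVertices
    ; complete = cComplete
    ; unique   = cUnique
    ; _⟶_      = CArc
    ; _⟶?_     = cArc?
    ; loopless = cLoopless
    }

-- T [ H ] is T[H₁,…,H_t], with the factors indexed by the vertices of T.
infix 8 _[_]
_[_] : (T : Digraph) → (Vertex T → Digraph) → Digraph
T [ H ] = Composition.composition T H

module _ {T : Digraph} {H : Vertex T → Digraph} {k : ℕ} where

  #coveredIn : Vertex T → PathSubdigraph k (T [ H ]) → ℕ
  #coveredIn i P = length (filter (λ x → covers? P (i , x)) (vertices (H i)))

IsMaximumValue : {A : Set} → (A → ℕ) → ℕ → Set
IsMaximumValue f m = (∃[ a ] f a ≡ m) × (∀ a → f a ≤ m)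

{-# OPTIONS --safe #-}
module Submission where

-- Cut every path of a k-path subdigraph of T[H₁,…,H_t] into maximal pieces lying
-- in one factor.  What remains is k walks in T, and the number m i of pieces in
-- H i is the number of visits to i.  More pieces never hurt: as long as there are
-- fewer pieces than vertices in H i, a piece can be split or a vertex added.  So it
-- suffices to maximise all m i simultaneously.
--
-- By a Hall-type argument, m is the visit vector of k walks and some cycles of T iff
-- (besides |m| ≥ k) m(R) ≤ k + m(N⁺(R)) for all sets R of vertices of T.  In a
-- semicomplete digraph R \ N⁺(R) has at most one element u, so the inequality reads
-- m u ≤ k + m(N⁺(R) \ R), and such inequalities are preserved by pointwise maxima.
-- Finally, in a semicomplete digraph a cycle can be absorbed by any walk, with the
-- same total number of visits to each vertex.

open import Defs
open import Data.Bool using (if_then_else_)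
open import Data.Fin using (Fin; zero; suc)
open import Data.List using (List; []; _∷_; _++_; length; map; concat; concatMap; filter; lookup; tabulate)
open import Data.List.Membership.Propositional using (_∈_; _∉_; find; lose)
open import Data.List.Membership.Propositional.Properties using (∈-∃++; ∈-map⁺; ∈-map⁻; ∈-++⁺ˡ; ∈-++⁺ʳ; ∈-++⁻; ∈-concat⁺′; ∈-filter⁺; ∈-filter⁻; ∈-lookup; ∈-tabulate⁺)
open import Data.List.Properties using (length-++; ++-assoc; length-map; ++-identityʳ; filter-++; filter-notAll; concatMap-++; length-tabulate; concatMap-map; map-concatMap)
open import Data.List.Relation.Binary.Disjoint.Propositional using (Disjoint)
open import Data.List.Relation.Binary.Permutation.Propositional using (_↭_; refl; prep; swap; trans; ↭-sym; ↭-trans; ↭-refl; ↭-reflexive; ↭⇒↭ₛ)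
open import Data.List.Relation.Binary.Permutation.Propositional.Properties using (∈-resp-↭; ↭-length; shift; shifts; map⁺; ++⁺ˡ; ++⁺ʳ; ++-comm; All-resp-↭)
open import Data.List.Relation.Unary.All using (All; []; _∷_)
open import Data.List.Relation.Unary.AllPairs using ([]; _∷_)
open import Data.List.Relation.Unary.Any using (here; there; any?)
open import Data.List.Relation.Unary.Linked using (Linked; [-]; _∷_)
open import Data.List.Relation.Unary.Unique.Propositional using (Unique)
open import Data.Nat using (ℕ; zero; suc; _+_; _*_; _≤_; _<_; z≤n; s≤s; _<?_; _≤?_)
open import Data.Nat.ListAction using (sum)
open import Data.Nat.ListAction.Properties using (sum-↭)
open import Data.Nat.Properties hiding (_≟_)
open import Data.Nat.Tactic.RingSolver using (solve-∀)
open import Data.Product using (Σ; ∃-syntax; _×_; _,_; proj₁; proj₂)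
open import Data.Sum using (_⊎_; inj₁; inj₂)
open import Function using (_∘_)
open import Level using (0ℓ)
open import Relation.Binary.PropositionalEquality using (_≡_; _≢_; refl; sym; cong; cong₂; subst; setoid; module ≡-Reasoning) renaming (trans to ≡-trans)
open import Relation.Nullary using (¬_; Dec; yes; no; does; ¬?; _×-dec_; contradiction)
open import Relation.Unary using (Pred; Decidable)
import Data.List.Membership.DecPropositional as DecMembership
import Data.List.Relation.Binary.Permutation.Setoid.Properties as Permutationₛ
import Data.List.Relation.Unary.All as All
import Data.List.Relation.Unary.All.Properties as Allₚ
import Data.List.Relation.Unary.AllPairs as AllPairs
import Data.List.Relation.Unary.AllPairs.Properties as AllPairsₚ
import Data.List.Relation.Unary.Unique.Propositional.Properties as Uniqueₚ

-- Lists, permutations and finite sums.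

private
  variable
    A B C : Set

∈⇒↭ : ∀ {x : A} {xs} → x ∈ xs → ∃[ ys ] xs ↭ x ∷ ys
∈⇒↭ x∈xs with ∈-∃++ x∈xs
... | ys , zs , refl = ys ++ zs , shift _ ys zs

Unique-⊆⇒length≤ : ∀ {xs ys : List A} → Unique xs → (∀ {x} → x ∈ xs → x ∈ ys) → length xs ≤ length ys
Unique-⊆⇒length≤ [] _ = z≤n
Unique-⊆⇒length≤ {xs = x ∷ xs} {ys} (x≢ ∷ u) sub with ∈⇒↭ (sub (here refl))
... | zs , p = subst (suc (length xs) ≤_) (sym (↭-length p)) (s≤s (Unique-⊆⇒length≤ u sub′))
  where
  sub′ : ∀ {y} → y ∈ xs → y ∈ zs
  sub′ y∈ with ∈-resp-↭ p (sub (there y∈))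
  ... | here refl = contradiction refl (All.lookup x≢ y∈)
  ... | there y∈zs = y∈zs

concatMap-↭ : ∀ (f : A → List B) {xs ys} → xs ↭ ys → concatMap f xs ↭ concatMap f ys
concatMap-↭ f refl         = ↭-refl
concatMap-↭ f (prep x p)   = ++⁺ˡ (f x) (concatMap-↭ f p)
concatMap-↭ f (swap x y p) = ↭-trans (shifts (f x) (f y)) (++⁺ˡ (f y) (++⁺ˡ (f x) (concatMap-↭ f p)))
concatMap-↭ f (trans p q)  = ↭-trans (concatMap-↭ f p) (concatMap-↭ f q)

argmax : ∀ (f : A → ℕ) x xs → ∃[ m ] (∀ {y} → y ∈ x ∷ xs → f y ≤ f m)
argmax f x [] = x , λ { (here refl) → ≤-refl }
argmax f x (y ∷ ys) with argmax f y ys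
... | m , m-max with ≤-total (f x) (f m)
...   | inj₁ x≤m = m , λ { (here refl) → x≤m ; (there z∈) → m-max z∈ }
...   | inj₂ m≤x = x , λ { (here refl) → ≤-refl ; (there z∈) → ≤-trans (m-max z∈) m≤x }

sumOver : (A → ℕ) → List A → ℕ
sumOver f xs = sum (map f xs)

sumOver-↭ : ∀ (f : A → ℕ) {xs ys} → xs ↭ ys → sumOver f xs ≡ sumOver f ys
sumOver-↭ f p = sum-↭ (map⁺ f p)

sumOver-++ : ∀ (f : A → ℕ) xs ys → sumOver f (xs ++ ys) ≡ sumOver f xs + sumOver f ys
sumOver-++ f []       ys = refl
sumOver-++ f (x ∷ xs) ys = ≡-trans (cong (f x +_) (sumOver-++ f xs ys)) (sym (+-assoc (f x) _ _))

sumOver-mono : ∀ {f g : A → ℕ} xs → (∀ {x} → x ∈ xs → f x ≤ g x) → sumOver f xs ≤ sumOver g xs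
sumOver-mono []       _   = z≤n
sumOver-mono (x ∷ xs) f≤g = +-mono-≤ (f≤g (here refl)) (sumOver-mono xs (f≤g ∘ there))

sumOver-cong : ∀ {f g : A → ℕ} xs → (∀ x → f x ≡ g x) → sumOver f xs ≡ sumOver g xs
sumOver-cong []       _   = refl
sumOver-cong (x ∷ xs) f≡g = cong₂ _+_ (f≡g x) (sumOver-cong xs f≡g)

sumOver-+ : ∀ (f g : A → ℕ) xs → sumOver (λ x → f x + g x) xs ≡ sumOver f xs + sumOver g xs
sumOver-+ f g []       = refl
sumOver-+ f g (x ∷ xs) rewrite sumOver-+ f g xs = interchange (f x) (g x) _ _
  where
  interchange : ∀ a b c d → a + b + (c + d) ≡ a + c + (b + d)
  interchange = solve-∀

sumOver-1 : ∀ (xs : List A) → sumOver (λ _ → 1) xs ≡ length xs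
sumOver-1 []       = refl
sumOver-1 (x ∷ xs) = cong suc (sumOver-1 xs)

sumOver-0 : ∀ {f : A → ℕ} xs → (∀ {x} → x ∈ xs → f x ≡ 0) → sumOver f xs ≡ 0
sumOver-0 []       _   = refl
sumOver-0 (x ∷ xs) f≡0 = cong₂ _+_ (f≡0 (here refl)) (sumOver-0 xs (f≡0 ∘ there))

-- Termwise inequalities in one direction cannot compensate for one another. This is how equality of
-- total coverage becomes equality in each factor.
sumOver-squeeze : ∀ {f g : A → ℕ} xs → (∀ x → f x ≤ g x) → sumOver g xs ≤ sumOver f xs →
                  ∀ {x} → x ∈ xs → f x ≡ g x
sumOver-squeeze {f = f} {g} (x ∷ xs) f≤g Σg≤Σf (here refl) =
  ≤-antisym (f≤g x) (+-cancelʳ-≤ (sumOver g xs) (g x) (f x)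
    (≤-trans Σg≤Σf (+-monoʳ-≤ (f x) (sumOver-mono xs (λ {y} _ → f≤g y)))))
sumOver-squeeze {f = f} {g} (x ∷ xs) f≤g Σg≤Σf (there y∈) =
  sumOver-squeeze xs f≤g (+-cancelˡ-≤ (g x) _ _ (≤-trans Σg≤Σf (+-monoˡ-≤ _ (f≤g x)))) y∈

⟦_⟧ : {P : Set} → Dec P → ℕ
⟦ d ⟧ = if does d then 1 else 0

⟦⟧-yes : {P : Set} (d : Dec P) → P → ⟦ d ⟧ ≡ 1
⟦⟧-yes (yes _) _ = refl
⟦⟧-yes (no ¬p) p = contradiction p ¬p

⟦⟧-no : {P : Set} (d : Dec P) → ¬ P → ⟦ d ⟧ ≡ 0
⟦⟧-no (yes p) ¬p = contradiction p ¬p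
⟦⟧-no (no _)  _  = refl

Unique-resp-↭ : ∀ {xs ys : List A} → xs ↭ ys → Unique xs → Unique ys
Unique-resp-↭ {A} p = Permutationₛ.Unique-resp-↭ (setoid A) (↭⇒↭ₛ p)

Unique-++⁻ : ∀ (xs : List A) {ys} → Unique (xs ++ ys) → Unique xs × Unique ys × Disjoint xs ys
Unique-++⁻ []       u        = [] , u , λ ()
Unique-++⁻ (x ∷ xs) (x≢ ∷ u) =
  let u₁ , u₂ , disj = Unique-++⁻ xs u
  in Allₚ.++⁻ˡ xs x≢ ∷ u₁ , u₂ ,
     λ { (here refl , y∈) → All.lookup (Allₚ.++⁻ʳ xs x≢) y∈ refl ; (there x∈ , y∈) → disj (x∈ , y∈) }

Unique-concatMap⁻ : ∀ (f : A → List B) xs → Unique (concatMap f xs) → ∀ i → Unique (f (lookup xs i))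
Unique-concatMap⁻ f (x ∷ xs) u zero    = proj₁ (Unique-++⁻ (f x) u)
Unique-concatMap⁻ f (x ∷ xs) u (suc i) = Unique-concatMap⁻ f xs (proj₁ (proj₂ (Unique-++⁻ (f x) u))) i

∈-concatMap-lookup : ∀ (f : A → List B) xs i {y} → y ∈ f (lookup xs i) → y ∈ concatMap f xs
∈-concatMap-lookup f xs i y∈ = ∈-concat⁺′ y∈ (∈-map⁺ f (∈-lookup {xs = xs} i))

∈-concatMap⇒lookup : ∀ (f : A → List B) xs {y} → y ∈ concatMap f xs → ∃[ i ] y ∈ f (lookup xs i)
∈-concatMap⇒lookup f (x ∷ xs) y∈ with ∈-++⁻ (f x) y∈
... | inj₁ y∈x  = zero , y∈x
... | inj₂ y∈xs = let i , y∈i = ∈-concatMap⇒lookup f xs y∈xs in suc i , y∈i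

Disjoint-concatMap⁻ : ∀ (f : A → List B) xs → Unique (concatMap f xs) →
                      ∀ {i j} → i ≢ j → Disjoint (f (lookup xs i)) (f (lookup xs j))
Disjoint-concatMap⁻ f (x ∷ xs) u {zero}  {zero}  i≢j _         = i≢j refl
Disjoint-concatMap⁻ f (x ∷ xs) u {zero}  {suc j} _   (y∈ , z∈) =
  proj₂ (proj₂ (Unique-++⁻ (f x) u)) (y∈ , ∈-concatMap-lookup f xs j z∈)
Disjoint-concatMap⁻ f (x ∷ xs) u {suc i} {zero}  _   (y∈ , z∈) =
  proj₂ (proj₂ (Unique-++⁻ (f x) u)) (z∈ , ∈-concatMap-lookup f xs i y∈)
Disjoint-concatMap⁻ f (x ∷ xs) u {suc i} {suc j} i≢j =
  Disjoint-concatMap⁻ f xs (proj₁ (proj₂ (Unique-++⁻ (f x) u))) (i≢j ∘ cong suc)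

concatMap-concatMap : ∀ (f : B → List C) (g : A → List B) xs →
                      concatMap f (concatMap g xs) ≡ concatMap (concatMap f ∘ g) xs
concatMap-concatMap f g []       = refl
concatMap-concatMap f g (x ∷ xs) =
  ≡-trans (concatMap-++ f (g x) (concatMap g xs)) (cong (concatMap f (g x) ++_) (concatMap-concatMap f g xs))

length-filter-map : ∀ {P : Pred B 0ℓ} (P? : Decidable P) (f : A → B) xs →
                    length (filter P? (map f xs)) ≡ length (filter (P? ∘ f) xs)
length-filter-map P? f [] = refl
length-filter-map P? f (x ∷ xs) with P? (f x)
... | yes _ = cong suc (length-filter-map P? f xs)
... | no  _ = length-filter-map P? f xs

-- Counting by vertices of `T`.

module Counting (T : Digraph) where

  open Digraph T renaming (Vertex to V; vertices to vs)

  total : (V → ℕ) → ℕ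
  total f = sumOver f vs

  cnt : (A → V) → List A → V → ℕ
  cnt h xs i = sumOver (λ x → ⟦ h x ≟ i ⟧) xs

  cnt-↭ : ∀ (h : A → V) {xs ys} → xs ↭ ys → ∀ i → cnt h xs i ≡ cnt h ys i
  cnt-↭ h p i = sumOver-↭ (λ x → ⟦ h x ≟ i ⟧) p

  private
    sumOver-pick : ∀ (g : V → ℕ) {a xs} → Unique xs → a ∈ xs → sumOver (λ i → g i * ⟦ a ≟ i ⟧) xs ≡ g a
    sumOver-pick g {a} {.a ∷ xs} (a≢ ∷ _) (here refl)
      rewrite ⟦⟧-yes (a ≟ a) refl
            | sumOver-0 {f = λ i → g i * ⟦ a ≟ i ⟧} xs
                (λ {i} i∈ → ≡-trans (cong (g i *_) (⟦⟧-no (a ≟ i) (All.lookup a≢ i∈))) (*-zeroʳ (g i)))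
      = ≡-trans (+-identityʳ _) (*-identityʳ _)
    sumOver-pick g {a} {x ∷ xs} (x≢ ∷ u) (there a∈)
      rewrite ⟦⟧-no (a ≟ x) (λ a≡x → All.lookup x≢ a∈ (sym a≡x)) | *-zeroʳ (g x)
      = sumOver-pick g u a∈

  -- Double counting: each `x` contributes `g (h x)`, at the single vertex `h x`. Weights on
  -- vertices thus become weights on arcs.
  total-cnt : ∀ (h : A → V) (g : V → ℕ) xs → total (λ i → g i * cnt h xs i) ≡ sumOver (g ∘ h) xs
  total-cnt h g []       = sumOver-0 vs (λ {i} _ → *-zeroʳ (g i))
  total-cnt h g (x ∷ xs) = begin
    total (λ i → g i * (⟦ h x ≟ i ⟧ + cnt h xs i))
      ≡⟨ sumOver-cong vs (λ i → *-distribˡ-+ (g i) ⟦ h x ≟ i ⟧ _) ⟩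
    total (λ i → g i * ⟦ h x ≟ i ⟧ + g i * cnt h xs i)
      ≡⟨ sumOver-+ (λ i → g i * ⟦ h x ≟ i ⟧) (λ i → g i * cnt h xs i) vs ⟩
    total (λ i → g i * ⟦ h x ≟ i ⟧) + total (λ i → g i * cnt h xs i)
      ≡⟨ cong₂ _+_ (sumOver-pick g unique (complete (h x))) (total-cnt h g xs) ⟩
    g (h x) + sumOver (g ∘ h) xs ∎
    where open ≡-Reasoning

  total-cnt-1 : ∀ (h : A → V) xs → total (cnt h xs) ≡ length xs
  total-cnt-1 h xs = ≡-trans (sumOver-cong vs (λ i → sym (*-identityˡ _)))
                             (≡-trans (total-cnt h (λ _ → 1) xs) (sumOver-1 xs))

  cnt>0⇒↭ : ∀ (h : A → V) xs a → 0 < cnt h xs a → ∃[ x ] ∃[ ys ] (h x ≡ a × xs ↭ x ∷ ys)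
  cnt>0⇒↭ h (x ∷ xs) a 0< with h x ≟ a
  ... | yes hx≡a = x , xs , hx≡a , ↭-refl
  ... | no  _    with cnt>0⇒↭ h xs a 0<
  ...   | y , ys , hy≡a , p = y , x ∷ ys , hy≡a , ↭-trans (prep x p) (swap x y ↭-refl)

-- Arc systems bounded by a visit vector.

module Transport (T : Digraph) (semicomplete : Semicomplete T) where

  open Digraph T renaming (Vertex to V; vertices to vs)
  open Counting T
  open DecMembership _≟_ using (_∈?_)

  Arc : Set
  Arc = V × V

  IsArc : Arc → Set
  IsArc (a , b) = a ⟶ b

  -- A b-matching: each vertex has an out-copy and an in-copy, both of capacity `N i`, and an arc of
  -- `T` joins the out-copy of its tail to the in-copy of its head. Being a list, `arcs` may repeat
  -- an arc.
  record ArcSystem (N : V → ℕ) : Set where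
    field
      arcs  : List Arc
      valid : All IsArc arcs
      out≤  : ∀ i → cnt proj₁ arcs i ≤ N i
      in≤   : ∀ i → cnt proj₂ arcs i ≤ N i

  open ArcSystem public

  -- The arcs of k walks and some cycles visiting each i exactly m i times: a walk
  -- has one arc fewer than visits, a cycle equally many.
  Realisable : ℕ → (V → ℕ) → Set
  Realisable k m = ∃[ S ] (length (arcs {m} S) + k ≡ total m)

  -- Alternating paths and the Hall-type count.

  module Augmentation (k : ℕ) (N : V → ℕ)
    (attained : ∀ u → ∃[ m ] (Realisable k m × (∀ i → m i ≤ N i) × m u ≡ N u))
    (S : ArcSystem N) (S-small : length (arcs S) + k < total N) where

    private
      E = arcs S

      Target : Set
      Target = ∃[ S′ ] length (arcs {N} S′) ≡ suc (length E)

      -- A system with as many arcs as S in which z still has room for an arc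
      -- leaving it; only arcs leaving vertices outside U were exchanged.
      record Spare (U : List V) (z : V) : Set where
        field
          system : ArcSystem N
          size   : length (arcs system) ≡ length E
          ins    : ∀ i → cnt proj₂ (arcs system) i ≡ cnt proj₂ E i
          room   : cnt proj₁ (arcs system) z < N z
          kept   : ∀ {e} → e ∈ E → proj₁ e ∈ U → e ∈ arcs system

      open Spare

      augment-at : ∀ {U z a} → Spare U z → z ⟶ a → cnt proj₂ E a < N a → Target
      augment-at {U} {z} {a} s za a-room = record
        { arcs  = (z , a) ∷ F
        ; valid = za ∷ valid (system s)
        ; out≤  = out′
        ; in≤   = in′
        } , cong suc (size s)
        where
        F = arcs (system s)
        out′ : ∀ i → cnt proj₁ ((z , a) ∷ F) i ≤ N i
        out′ i with z ≟ i
        ... | yes refl = room s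
        ... | no  _    = out≤ (system s) i
        in′ : ∀ i → cnt proj₂ ((z , a) ∷ F) i ≤ N i
        in′ i with a ≟ i
        ... | yes refl = subst (_< N a) (sym (ins s a)) a-room
        ... | no  _    = in≤ (system s) i

      remove : V → List V → List V
      remove c = filter (λ z → ¬? (z ≟ c))

      -- One alternating step: `(z , a)` replaces `(c , a)`, so in-degrees stay and the spare
      -- out-capacity moves from `z` to `c`. As an arc leaving `c` is given up, `c` is removed from
      -- `U`.
      exchange : ∀ {U z a c} → Spare U z → z ⟶ a → (c , a) ∈ E → c ∈ U → z ∉ U → Spare (remove c U) c
      exchange {U} {z} {a} {c} s za ca∈E c∈U z∉U with ∈⇒↭ (kept s ca∈E c∈U)
      ... | F , p = record
        { system = record
          { arcs  = (z , a) ∷ F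
          ; valid = za ∷ All.tail (All-resp-↭ p (valid (system s)))
          ; out≤  = out′
          ; in≤   = λ i → ≤-trans (≤-reflexive (sym (cnt-↭ proj₂ p i))) (in≤ (system s) i)
          }
        ; size = ≡-trans (sym (↭-length p)) (size s)
        ; ins  = λ i → ≡-trans (sym (cnt-↭ proj₂ p i)) (ins s i)
        ; room = room′
        ; kept = kept′
        }
        where
        out-split : ∀ i → cnt proj₁ (arcs (system s)) i ≡ ⟦ c ≟ i ⟧ + cnt proj₁ F i
        out-split = cnt-↭ proj₁ p
        out′ : ∀ i → ⟦ z ≟ i ⟧ + cnt proj₁ F i ≤ N i
        out′ i with z ≟ i
        ... | yes refl = ≤-trans (s≤s (≤-trans (m≤n+m _ ⟦ c ≟ z ⟧) (≤-reflexive (sym (out-split z))))) (room s)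
        ... | no  _    = ≤-trans (≤-trans (m≤n+m _ ⟦ c ≟ i ⟧) (≤-reflexive (sym (out-split i)))) (out≤ (system s) i)
        room′ : ⟦ z ≟ c ⟧ + cnt proj₁ F c < N c
        room′ rewrite ⟦⟧-no (z ≟ c) (λ { refl → z∉U c∈U }) =
          ≤-trans (≤-reflexive (sym (≡-trans (out-split c) (cong (_+ cnt proj₁ F c) (⟦⟧-yes (c ≟ c) refl)))))
                  (out≤ (system s) c)
        kept′ : ∀ {e} → e ∈ E → proj₁ e ∈ remove c U → e ∈ (z , a) ∷ F
        kept′ e∈E e∈U′ with ∈-filter⁻ (λ w → ¬? (w ≟ c)) {xs = U} e∈U′
        ... | e∈U , e≢c with ∈-resp-↭ p (kept s e∈E e∈U)
        ...   | here refl = contradiction refl e≢c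
        ...   | there e∈F = there e∈F

      weaken : ∀ {U U′ z} → (∀ {c} → c ∈ U′ → c ∈ U) → Spare U z → Spare U′ z
      weaken sub s = record
        { system = system s ; size = size s ; ins = ins s ; room = room s
        ; kept = λ e∈E e∈U′ → kept s e∈E (sub e∈U′) }

      -- The reached vertices are those outside U.
      EntersFrom : List V → V → V → Set
      EntersFrom U a z = z ∉ U × z ⟶ a

      entersFrom? : ∀ U a → ∀ z → Dec (EntersFrom U a z)
      entersFrom? U a z = ¬? (z ∈? U) ×-dec (z ⟶? a)

      Entered : List V → V → Set
      Entered U a = ∃[ z ] EntersFrom U a z

      entered? : ∀ U a → Dec (Entered U a)
      entered? U a with any? (entersFrom? U a) vs
      ... | yes p = yes (let z , _ , q = find p in z , q)
      ... | no ¬p = no λ (z , q) → ¬p (lose (complete z) q)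

      Closed : List V → Set
      Closed U = ∀ {e} → e ∈ E → Entered U (proj₂ e) → proj₁ e ∉ U

      module Count (U : List V)
        (saturated-out : ∀ {z} → z ∈ U → N z ≤ cnt proj₁ E z)
        (saturated-in  : ∀ {a} → Entered U a → N a ≤ cnt proj₂ E a)
        (closed : Closed U) where

        -- The out-copies of `U` and the in-copies of entered vertices form a vertex cover, as in
        -- König's theorem; `θ i` counts the copies of `i` in it.
        χ η θ : V → ℕ
        χ i = ⟦ i ∈? U ⟧
        η i = ⟦ entered? U i ⟧
        θ i = η i + χ i

        private
          arcWeight : Arc → ℕ
          arcWeight e = η (proj₂ e) + χ (proj₁ e)

          θ-total : ∀ (m : V → ℕ) → total (λ i → θ i * m i) ≡ total (λ i → η i * m i) + total (λ i → χ i * m i)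
          θ-total m = ≡-trans (sumOver-cong vs (λ i → *-distribʳ-+ (m i) (η i) (χ i)))
                              (sumOver-+ (λ i → η i * m i) (λ i → χ i * m i) vs)

          weight-total : ∀ F → total (λ i → η i * cnt proj₂ F i) + total (λ i → χ i * cnt proj₁ F i) ≡ sumOver arcWeight F
          weight-total F = ≡-trans (cong₂ _+_ (total-cnt proj₂ η F) (total-cnt proj₁ χ F))
                                   (sym (sumOver-+ (η ∘ proj₂) (χ ∘ proj₁) F))

          -- Every copy in the cover is saturated by `E`, and by closedness no arc of `E` meets the
          -- cover twice.
          θN≤E : total (λ i → θ i * N i) ≤ length E
          θN≤E = begin
            total (λ i → θ i * N i) ≡⟨ θ-total N ⟩
            total (λ i → η i * N i) + total (λ i → χ i * N i)
              ≤⟨ +-mono-≤ (sumOver-mono vs (λ {i} _ → η-step i)) (sumOver-mono vs (λ {i} _ → χ-step i)) ⟩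
            total (λ i → η i * cnt proj₂ E i) + total (λ i → χ i * cnt proj₁ E i) ≡⟨ weight-total E ⟩
            sumOver arcWeight E ≤⟨ sumOver-mono E weight≤1 ⟩
            sumOver (λ _ → 1) E ≡⟨ sumOver-1 E ⟩
            length E ∎
            where
            open ≤-Reasoning
            η-step : ∀ i → η i * N i ≤ η i * cnt proj₂ E i
            η-step i with entered? U i
            ... | yes p = +-monoˡ-≤ 0 (saturated-in p)
            ... | no  _ = z≤n
            χ-step : ∀ i → χ i * N i ≤ χ i * cnt proj₁ E i
            χ-step i with i ∈? U
            ... | yes p = +-monoˡ-≤ 0 (saturated-out p)
            ... | no  _ = z≤n
            weight≤1 : ∀ {e} → e ∈ E → arcWeight e ≤ 1
            weight≤1 {c , a} e∈E with entered? U a | c ∈? U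
            ... | yes p | yes q = contradiction q (closed e∈E p)
            ... | yes _ | no  _ = ≤-refl
            ... | no  _ | yes _ = ≤-refl
            ... | no  _ | no  _ = z≤n

          -- Weak duality: an arc whose tail is outside `U` has an entered head, so every arc of `T`
          -- meets the cover.
          realisable≤θ : ∀ {m} (S′ : ArcSystem m) → length (arcs S′) ≤ total (λ i → θ i * m i)
          realisable≤θ {m} S′ = begin
            length F ≡⟨ sumOver-1 F ⟨
            sumOver (λ _ → 1) F ≤⟨ sumOver-mono F (λ e∈F → 1≤weight (All.lookup (valid S′) e∈F)) ⟩
            sumOver arcWeight F ≡⟨ weight-total F ⟨
            total (λ i → η i * cnt proj₂ F i) + total (λ i → χ i * cnt proj₁ F i)
              ≤⟨ +-mono-≤ (sumOver-mono vs (λ {i} _ → *-monoʳ-≤ (η i) (in≤ S′ i)))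
                          (sumOver-mono vs (λ {i} _ → *-monoʳ-≤ (χ i) (out≤ S′ i))) ⟩
            total (λ i → η i * m i) + total (λ i → χ i * m i) ≡⟨ θ-total m ⟨
            total (λ i → θ i * m i) ∎
            where
            open ≤-Reasoning
            F = arcs S′
            1≤weight : ∀ {e} → IsArc e → 1 ≤ arcWeight e
            1≤weight {c , a} ca with c ∈? U
            ... | yes _ = m≤n+m 1 _
            ... | no c∉U rewrite ⟦⟧-yes (entered? U a) (c , c∉U , ca) = s≤s z≤n

        -- The condition on `θ` gives `(θ i - 1) * (N i - m i) ≥ 0` at each `i`. After summation,
        -- `θN≤E` bounds the terms in `N`, and `realisable≤θ` bounds the `total m - k` arcs
        -- realising `m`.
        saturates : ∀ {m} → Realisable k m → (∀ i → m i ≤ N i) → (∀ i → 1 ≤ θ i ⊎ m i ≡ N i) →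
                    total N ≤ length E + k
        saturates {m} (S′ , size′) m≤N θ-or = +-cancelʳ-≤ (total (λ i → θ i * m i)) _ _ (begin
          total N + total (λ i → θ i * m i) ≡⟨ sumOver-+ N (λ i → θ i * m i) vs ⟨
          total (λ i → N i + θ i * m i) ≤⟨ sumOver-mono vs (λ {i} _ → pointwise i (θ-or i)) ⟩
          total (λ i → θ i * N i + m i) ≡⟨ sumOver-+ (λ i → θ i * N i) m vs ⟩
          total (λ i → θ i * N i) + total m ≤⟨ +-monoˡ-≤ (total m) θN≤E ⟩
          length E + total m ≡⟨ cong (length E +_) size′ ⟨
          length E + (length (arcs S′) + k) ≤⟨ +-monoʳ-≤ (length E) (+-monoˡ-≤ k (realisable≤θ S′)) ⟩
          length E + (total (λ i → θ i * m i) + k) ≡⟨ rearrange (length E) _ k ⟩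
          length E + k + total (λ i → θ i * m i) ∎)
          where
          open ≤-Reasoning
          rearrange : ∀ a b c → a + (b + c) ≡ a + c + b
          rearrange = solve-∀
          pointwise : ∀ i → 1 ≤ θ i ⊎ m i ≡ N i → N i + θ i * m i ≤ θ i * N i + m i
          pointwise i (inj₂ eq) rewrite eq = ≤-reflexive (+-comm (N i) _)
          pointwise i (inj₁ 1≤θ) with θ i | 1≤θ
          ... | suc t | _ = begin
            N i + (m i + t * m i) ≤⟨ +-monoʳ-≤ (N i) (+-monoʳ-≤ (m i) (*-monoʳ-≤ t (m≤N i))) ⟩
            N i + (m i + t * N i) ≡⟨ rearrange (N i) (m i) (t * N i) ⟩
            N i + t * N i + m i ∎

        -- Two reached vertices are joined by an arc, so at most one is not entered.
        E-maximum : V → total N ≤ length E + k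
        E-maximum v with any? (λ u → ¬? (u ∈? U) ×-dec ¬? (entered? U u)) vs
        -- `θ` vanishes at `u` alone, so a vector with `m u ≡ N u` serves; when `θ` vanishes
        -- nowhere, any attained vector does.
        ... | yes p = let u , _ , u∉U , u-free = find p
                          m , real , m≤N , m≡N = attained u
                      in saturates real m≤N (tight {m = m} u∉U u-free m≡N)
          where
          tight : ∀ {u} {m : V → ℕ} → u ∉ U → ¬ Entered U u → m u ≡ N u → ∀ i → 1 ≤ θ i ⊎ m i ≡ N i
          tight {u} u∉U u-free m≡N i with i ≟ u
          ... | yes refl = inj₂ m≡N
          ... | no i≢u with i ∈? U | entered? U i
          ...   | yes _   | d     = inj₁ (m≤n+m 1 ⟦ d ⟧)
          ...   | no  _   | yes _ = inj₁ ≤-refl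
          ...   | no i∉U  | no i-free with semicomplete i u i≢u
          ...     | inj₁ iu = contradiction (i , i∉U , iu) u-free
          ...     | inj₂ ui = contradiction (u , u∉U , ui) i-free
        ... | no ¬p = let m , real , m≤N , _ = attained v in saturates real m≤N (λ i → inj₁ (1≤θ i))
          where
          1≤θ : ∀ i → 1 ≤ θ i
          1≤θ i with i ∈? U | entered? U i
          ... | yes _  | d     = m≤n+m 1 ⟦ d ⟧
          ... | no  _  | yes _ = ≤-refl
          ... | no i∉U | no i-free = contradiction (lose (complete i) (i∉U , i-free)) ¬p

      -- `U` holds the vertices not yet reached. Either an entered vertex has in-room and the path
      -- ends there, or an arc of `E` from `U` to an entered vertex reaches a new vertex, or the
      -- cover shows that `E` is already too large for `S-small`. The fuel bounds the length of `U`,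
      -- which drops at each exchange.
      search : ∀ fuel U → length U < fuel → V →
               (∀ {z} → z ∈ U → N z ≤ cnt proj₁ E z) → (∀ z → z ∉ U → Spare U z) → Target
      search (suc fuel) U U<fuel v saturated spare
        with any? (λ a → entered? U a ×-dec (cnt proj₂ E a <? N a)) vs
      ... | yes p = let a , _ , (z , z∉U , za) , a-room = find p in augment-at (spare z z∉U) za a-room
      ... | no ¬room with any? (λ e → (proj₁ e ∈? U) ×-dec entered? U (proj₂ e)) E
      ...   | no ¬exit = contradiction (E-maximum v) (<⇒≱ S-small)
        where
        open Count U saturated
          (λ {a} en → ≮⇒≥ (λ lt → ¬room (lose (complete a) (en , lt))))
          (λ e∈E en c∈U → ¬exit (lose e∈E (c∈U , en)))
      ...   | yes p with find p
      ...     | (c , a) , ca∈E , c∈U , z , z∉U , za =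
        search fuel (remove c U) (<-≤-trans shorter (≤-pred U<fuel)) v (saturated ∘ sub) spare′
        where
        sub : ∀ {w} → w ∈ remove c U → w ∈ U
        sub = proj₁ ∘ ∈-filter⁻ (λ w → ¬? (w ≟ c)) {xs = U}
        shorter : length (remove c U) < length U
        shorter = filter-notAll (λ w → ¬? (w ≟ c)) U (lose c∈U (λ c≢c → c≢c refl))
        spare′ : ∀ w → w ∉ remove c U → Spare (remove c U) w
        spare′ w w∉ with w ≟ c
        ... | yes refl = exchange (spare z z∉U) za ca∈E c∈U z∉U
        ... | no  w≢c  = weaken sub (spare w (λ w∈U → w∉ (∈-filter⁺ (λ x → ¬? (x ≟ c)) w∈U w≢c)))

    augment : V → Target
    augment v = search (suc (length U₀)) U₀ ≤-refl v (proj₂ ∘ ∈-filter⁻ full? {xs = vs}) start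
      where
      full? = λ z → N z ≤? cnt proj₁ E z
      -- At the start only vertices with full out-capacity are unreached; the others have room in
      -- `S` itself.
      U₀ = filter full? vs
      start : ∀ z → z ∉ U₀ → Spare U₀ z
      start z z∉ = record
        { system = S ; size = refl ; ins = λ _ → refl
        ; room = ≰⇒> (λ le → z∉ (∈-filter⁺ full? (complete z) le)) ; kept = λ e∈E _ → e∈E }

  -- Closure under pointwise maxima: each coordinate of such a maximum is attained by a realisable
  -- vector below it. The system grows from no arcs by repeated augmentation.
  realisable-join : ∀ k N → V → (∀ u → ∃[ m ] (Realisable k m × (∀ i → m i ≤ N i) × m u ≡ N u)) → Realisable k N
  -- A realisable vector has total at least `k`, hence so has `N`; `d` is `total N - k`, the number
  -- of arcs to be placed.
  realisable-join k N v attained = let d , eq = m≤n⇒∃[o]m+o≡n k≤N in grow d none (≡-trans (+-comm d k) eq)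
    where
    k≤N : k ≤ total N
    k≤N = let m , (S , size) , m≤N , _ = attained v
          in ≤-trans (m+n≤o⇒n≤o (length (arcs S)) (≤-reflexive size)) (sumOver-mono vs (λ {i} _ → m≤N i))
    none : ArcSystem N
    none = record { arcs = [] ; valid = [] ; out≤ = λ _ → z≤n ; in≤ = λ _ → z≤n }
    grow : ∀ d (S : ArcSystem N) → d + (length (arcs S) + k) ≡ total N → Realisable k N
    grow zero    S eq = S , eq
    grow (suc d) S eq =
      let S′ , size = Augmentation.augment k N attained S (≤-trans (s≤s (m≤n+m _ d)) (≤-reflexive eq)) v
      in grow d S′ (≡-trans (cong (λ l → d + (l + k)) size) (≡-trans (+-suc d _) eq))

-- Walks in `T` and their rearrangement.

-- A walk in T is recorded by labels of its visits; cl gives the visited vertex.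
module Walks (T : Digraph) (semicomplete : Semicomplete T) (X : Set) (cl : X → Digraph.Vertex T) where

  open Digraph T renaming (Vertex to V; vertices to vs)
  open Counting T
  open Transport T semicomplete

  infixr 5 _∷⟨_⟩_

  data Walk : V → V → List X → Set where
    visit   : ∀ x → Walk (cl x) (cl x) (x ∷ [])
    _∷⟨_⟩_ : ∀ x {b c xs} → cl x ⟶ b → Walk b c xs → Walk (cl x) c (x ∷ xs)

  join : ∀ {a b c d xs ys} → Walk a b xs → b ⟶ c → Walk c d ys → Walk a d (xs ++ ys)
  join (visit x)            bc v = x ∷⟨ bc ⟩ v
  join (x ∷⟨ xa ⟩ w) bc v = x ∷⟨ xa ⟩ join w bc v

  target-visited : ∀ {a b xs} → Walk a b xs → ∃[ x ] (x ∈ xs × cl x ≡ b)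
  target-visited (visit x)            = x , here refl , refl
  target-visited (_ ∷⟨ _ ⟩ w) = let x , x∈ , eq = target-visited w in x , there x∈ , eq

  source-visited : ∀ {a b xs} → Walk a b xs → ∃[ x ] (x ∈ xs × cl x ≡ a)
  source-visited (visit x)            = x , here refl , refl
  source-visited (x ∷⟨ _ ⟩ _) = x , here refl , refl

  walk-predecessor : ∀ {a b xs} → Walk a b xs → ∀ {y} → y ∈ xs → cl y ≡ a ⊎ ∃[ z ] (z ∈ xs × cl z ⟶ cl y)
  walk-predecessor (visit x)          (here refl) = inj₁ refl
  walk-predecessor (x ∷⟨ _ ⟩ _)   (here refl) = inj₁ refl
  walk-predecessor (x ∷⟨ xa ⟩ w) (there y∈) with walk-predecessor w y∈
  ... | inj₁ y≡b           = inj₂ (x , here refl , subst (cl x ⟶_) (sym y≡b) xa)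
  ... | inj₂ (z , z∈ , zy) = inj₂ (z , there z∈ , zy)

  cycle-predecessor : ∀ {a b xs} → Walk a b xs → b ⟶ a → ∀ {y} → y ∈ xs → ∃[ z ] (z ∈ xs × cl z ⟶ cl y)
  cycle-predecessor w ba y∈ with walk-predecessor w y∈
  ... | inj₂ found    = found
  ... | inj₁ refl with target-visited w
  ...   | z , z∈ , refl = z , z∈ , ba

  -- The first alternative is the cut after the last visit: the remainder would be empty, which no
  -- `Walk` is.
  split : ∀ {a b xs} → Walk a b xs → ∀ {y} → y ∈ xs →
          Walk a (cl y) xs × cl y ≡ b ⊎
          ∃[ c ] ∃[ us ] ∃[ ws ] (Walk a (cl y) us × cl y ⟶ c × Walk c b ws × us ++ ws ≡ xs)
  split (visit x)          (here refl) = inj₁ (visit x , refl)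
  split (x ∷⟨ xa ⟩ w) (here refl) = inj₂ (_ , _ , _ , visit x , xa , w , refl)
  split (x ∷⟨ xa ⟩ w) (there y∈) with split w y∈
  ... | inj₁ (u , eq) = inj₁ (x ∷⟨ xa ⟩ u , eq)
  ... | inj₂ (c , us , ws , u , yc , v , refl) = inj₂ (c , _ , ws , x ∷⟨ xa ⟩ u , yc , v , refl)

  rotate : ∀ {a b xs} → Walk a b xs → b ⟶ a → ∀ {y} → y ∈ xs →
           ∃[ c ] ∃[ zs ] (Walk c (cl y) zs × cl y ⟶ c × zs ↭ xs)
  rotate w ba y∈ with split w y∈
  ... | inj₁ (u , refl) = _ , _ , u , ba , ↭-refl
  ... | inj₂ (c , us , ws , u , yc , v , refl) = c , ws ++ us , join v ba u , yc , ++-comm ws us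

  -- Absorbing a cycle into a walk.

  module Absorb {c d ys} (cycle : Walk c d ys) (back : d ⟶ c) where

    private
      Dominates : V → Set
      Dominates a = ∀ {y} → y ∈ ys → a ⟶ cl y

      enters? : ∀ a → Dec (∃[ y ] (y ∈ ys × cl y ⟶ a))
      enters? a with any? (λ y → cl y ⟶? a) ys
      ... | yes p = yes (find p)
      ... | no ¬p = no λ (y , y∈ , ya) → ¬p (lose y∈ ya)

      -- A vertex of the cycle equal to a would be entered from the cycle.
      not-entered⇒dominates : ∀ {a} → ¬ (∃[ y ] (y ∈ ys × cl y ⟶ a)) → Dominates a
      not-entered⇒dominates {a} ¬enter {y} y∈ with a ≟ cl y
      ... | yes refl = contradiction (cycle-predecessor cycle back y∈) ¬enter
      ... | no a≢y with semicomplete a (cl y) a≢y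
      ...   | inj₁ ay = ay
      ...   | inj₂ ya = contradiction (y , y∈ , ya) ¬enter

      -- The invariant is that the current vertex dominates the cycle. Once the cycle enters the
      -- next vertex, it is rotated to end at an entering visit and inserted between the two; if
      -- that never happens, it is appended after the last visit.
      insert : ∀ {a b xs} → Dominates a → Walk a b xs → ∃[ b′ ] ∃[ zs ] (Walk a b′ zs × zs ↭ ys ++ xs)
      insert dom (visit x) with source-visited cycle
      ... | y , y∈ , refl = d , x ∷ ys , x ∷⟨ dom y∈ ⟩ cycle , ++-comm (x ∷ []) ys
      insert dom (_∷⟨_⟩_ x {b} {_} {xs} xb w) with enters? b
      ... | no ¬enter = let b′ , zs , v , p = insert (not-entered⇒dominates ¬enter) w
                        in b′ , x ∷ zs , x ∷⟨ xb ⟩ v , ↭-trans (prep x p) (shifts (x ∷ []) ys)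
      ... | yes (y , y∈ , yb) with rotate cycle back y∈
      ...   | e , zs , u , _ , p with source-visited u
      ...     | z , z∈ , refl = _ , x ∷ zs ++ xs , x ∷⟨ dom (∈-resp-↭ p z∈) ⟩ join u yb w ,
                                ↭-trans (prep x (++⁺ʳ xs p)) (shifts (x ∷ []) ys)

    -- If the cycle enters the first vertex, it goes in front; otherwise that vertex dominates it
    -- and `insert` can start.
    absorb : ∀ {a b xs} → Walk a b xs → ∃[ a′ ] ∃[ b′ ] ∃[ zs ] (Walk a′ b′ zs × zs ↭ ys ++ xs)
    absorb {a} w with enters? a
    ... | no ¬enter = _ , insert (not-entered⇒dominates ¬enter) w
    ... | yes (y , y∈ , ya) = let e , zs , u , _ , p = rotate cycle back y∈
                              in e , _ , _ , join u ya w , ++⁺ʳ _ p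

  record OpenWalk : Set where
    constructor open-walk
    field
      {source target} : V
      {visits}        : List X
      walk            : Walk source target visits

  open OpenWalk public

  Cycle : Set
  Cycle = Σ OpenWalk λ w → target w ⟶ source w

  allVisits : List OpenWalk → List X
  allVisits = concatMap visits

  cycleVisits : List Cycle → List X
  cycleVisits = concatMap (visits ∘ proj₁)

  absorb-all : ∀ w Cs → ∃[ w′ ] visits w′ ↭ visits w ++ cycleVisits Cs
  absorb-all w [] = w , ↭-reflexive (sym (++-identityʳ _))
  absorb-all w ((c , back) ∷ Cs) with Absorb.absorb (walk c) back (walk w)
  ... | _ , _ , _ , v , p =
    let w′ , q = absorb-all (open-walk v) Cs
    in w′ , ↭-trans q (↭-trans (++⁺ʳ (cycleVisits Cs) p)
              (↭-trans (↭-reflexive (++-assoc (visits c) (visits w) _)) (shifts (visits c) (visits w))))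

  -- Linking visits along the arcs of a system.

  private
    -- The state once the arcs `E` are used. Each visit either ends an open walk or has an outgoing
    -- arc in `E`, and dually for sources. Visits on cycles have both arcs, so cycles do not enter
    -- these counts.
    record Linking (L : List X) (E : List Arc) : Set where
      field
        opens   : List OpenWalk
        cycles  : List Cycle
        visited : allVisits opens ++ cycleVisits cycles ↭ L
        number  : length opens + length E ≡ length L
        targets : ∀ i → cnt target opens i + cnt proj₁ E i ≡ cnt cl L i
        sources : ∀ i → cnt source opens i + cnt proj₂ E i ≡ cnt cl L i

    open Linking

    singletons : ∀ L → Linking L []
    singletons L = record
      { opens   = map single L
      ; cycles  = []
      ; visited = ↭-reflexive (≡-trans (++-identityʳ _) (visits-single L))
      ; number  = ≡-trans (+-identityʳ _) (length-map single L)
      ; targets = λ i → ≡-trans (+-identityʳ _) (target-single i L)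
      ; sources = λ i → ≡-trans (+-identityʳ _) (source-single i L)
      }
      where
      single : X → OpenWalk
      single x = open-walk (visit x)
      visits-single : ∀ L → allVisits (map single L) ≡ L
      visits-single []       = refl
      visits-single (x ∷ xs) = cong (x ∷_) (visits-single xs)
      target-single : ∀ i L → cnt target (map single L) i ≡ cnt cl L i
      target-single i []       = refl
      target-single i (x ∷ xs) = cong (⟦ cl x ≟ i ⟧ +_) (target-single i xs)
      source-single : ∀ i L → cnt source (map single L) i ≡ cnt cl L i
      source-single i []       = refl
      source-single i (x ∷ xs) = cong (⟦ cl x ≟ i ⟧ +_) (source-single i xs)

    move : ∀ p q r {s} → (p + q) + r ≡ s → q + (p + r) ≡ s
    move p q r eq = ≡-trans (lemma p q r) eq
      where
      lemma : ∀ p q r → q + (p + r) ≡ (p + q) + r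
      lemma = solve-∀

    available : ∀ {p q r} → p + q ≡ r → suc q ≤ r → 0 < p
    available {p} {q} refl le = +-cancelʳ-≤ q 1 p le

    -- The room at `a` and `b` yields an open walk ending at `a` and one starting at `b`. The arc
    -- closes a cycle if the chosen walk does both, and otherwise joins two walks; either way one
    -- open walk is lost.
    link-arc : ∀ {L E a b} → a ⟶ b → Linking L E →
               suc (cnt proj₁ E a) ≤ cnt cl L a → suc (cnt proj₂ E b) ≤ cnt cl L b → Linking L ((a , b) ∷ E)
    link-arc {L} {E} {a} {b} ab K a-room b-room
      with cnt>0⇒↭ target (opens K) a (available (targets K a) a-room)
    ... | w , ws , refl , p with source w ≟ b
    ...   | yes refl = record
      { opens   = ws
      ; cycles  = (w , ab) ∷ cycles K
      ; visited = ↭-trans (shifts (allVisits ws) (visits w))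
                    (↭-trans (↭-reflexive (sym (++-assoc (visits w) (allVisits ws) _)))
                      (↭-trans (++⁺ʳ _ (↭-sym (concatMap-↭ visits p))) (visited K)))
      ; number  = ≡-trans (+-suc _ _) (≡-trans (cong (_+ length E) (sym (↭-length p))) (number K))
      ; targets = λ i → move ⟦ target w ≟ i ⟧ _ _
                          (≡-trans (cong (_+ cnt proj₁ E i) (sym (cnt-↭ target p i))) (targets K i))
      ; sources = λ i → move ⟦ source w ≟ i ⟧ _ _
                          (≡-trans (cong (_+ cnt proj₂ E i) (sym (cnt-↭ source p i))) (sources K i))
      }
    -- Since `w` does not start at `b`, the walk starting there is among the remaining ones.
    ...   | no w≢b with cnt>0⇒↭ source ws b
                         (subst (0 <_) (≡-trans (cnt-↭ source p b) (cong (_+ cnt source ws b) (⟦⟧-no (source w ≟ b) w≢b)))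
                           (available (sources K b) b-room))
    ...     | u , us , refl , q = record
      { opens   = open-walk (join (walk w) ab (walk u)) ∷ us
      ; cycles  = cycles K
      ; visited = ↭-trans (++⁺ʳ _ (↭-trans (↭-reflexive (++-assoc (visits w) (visits u) _)) (↭-sym (concatMap-↭ visits r))))
                          (visited K)
      ; number  = ≡-trans (+-suc (suc (length us)) (length E)) (≡-trans (cong (_+ length E) (sym (↭-length r))) (number K))
      ; targets = λ i → move ⟦ target w ≟ i ⟧ _ _
                          (≡-trans (cong (_+ cnt proj₁ E i) (sym (cnt-↭ target r i))) (targets K i))
      ; sources = λ i → move ⟦ source u ≟ i ⟧ _ _
                          (≡-trans (cong (_+ cnt proj₂ E i) (sym (cnt-↭ source r′ i))) (sources K i))
      }
      where
      r : opens K ↭ w ∷ u ∷ us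
      r = ↭-trans p (prep w q)
      r′ : opens K ↭ u ∷ w ∷ us
      r′ = ↭-trans r (swap w u ↭-refl)

    link : ∀ L E → All IsArc E → (∀ i → cnt proj₁ E i ≤ cnt cl L i) → (∀ i → cnt proj₂ E i ≤ cnt cl L i) → Linking L E
    link L []            _          _   _   = singletons L
    link L ((a , b) ∷ E) (ab ∷ arcs) out in′ =
      link-arc ab (link L E arcs (λ i → ≤-trans (m≤n+m _ ⟦ a ≟ i ⟧) (out i)) (λ i → ≤-trans (m≤n+m _ ⟦ b ≟ i ⟧) (in′ i)))
        (subst (λ δ → δ + cnt proj₁ E a ≤ cnt cl L a) (⟦⟧-yes (a ≟ a) refl) (out a))
        (subst (λ δ → δ + cnt proj₂ E b ≤ cnt cl L b) (⟦⟧-yes (b ≟ b) refl) (in′ b))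

  -- By `number` exactly `k` open walks remain; as `1 ≤ k`, there is a first one, and it absorbs all
  -- the cycles.
  walks-through : ∀ {k} → 1 ≤ k → ∀ L → Realisable k (cnt cl L) → ∃[ ws ] (length ws ≡ k × allVisits ws ↭ L)
  walks-through {k} 1≤k L (S , size) =
    finish (opens K) (+-cancelʳ-≡ (length (arcs S)) (length (opens K)) k
                       (≡-trans (number K) (sym (≡-trans (+-comm k _) (≡-trans size (total-cnt-1 cl L))))))
           (visited K)
    where
    K = link L (arcs S) (valid S) (out≤ S) (in≤ S)
    finish : ∀ ws → length ws ≡ k → allVisits ws ++ cycleVisits (cycles K) ↭ L →
             ∃[ ws′ ] (length ws′ ≡ k × allVisits ws′ ↭ L)
    finish []       refl _ = contradiction 1≤k (λ ())
    finish (w ∷ ws) len p  =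
      let w′ , q = absorb-all w (cycles K)
      in w′ ∷ ws , len ,
         ↭-trans (++⁺ʳ (allVisits ws) q)
           (↭-trans (↭-reflexive (++-assoc (visits w) _ _))
             (↭-trans (++⁺ˡ (visits w) (++-comm (cycleVisits (cycles K)) (allVisits ws)))
               (↭-trans (↭-reflexive (sym (++-assoc (visits w) (allVisits ws) _))) p)))

  -- Arc systems read off from walks.

  walk-arcs : ∀ {a b xs} → Walk a b xs → List Arc
  walk-arcs (visit x)                    = []
  walk-arcs (_∷⟨_⟩_ x {b} _ w) = (cl x , b) ∷ walk-arcs w

  walk-arcs-valid : ∀ {a b xs} (w : Walk a b xs) → All IsArc (walk-arcs w)
  walk-arcs-valid (visit x)             = []
  walk-arcs-valid (x ∷⟨ xb ⟩ w) = xb ∷ walk-arcs-valid w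

  walk-arcs-length : ∀ {a b xs} (w : Walk a b xs) → suc (length (walk-arcs w)) ≡ length xs
  walk-arcs-length (visit x)            = refl
  walk-arcs-length (x ∷⟨ _ ⟩ w) = cong suc (walk-arcs-length w)

  walk-arcs-out : ∀ {a b xs} (w : Walk a b xs) i → cnt proj₁ (walk-arcs w) i ≤ cnt cl xs i
  walk-arcs-out (visit x)         i = z≤n
  walk-arcs-out (x ∷⟨ _ ⟩ w) i = +-monoʳ-≤ ⟦ cl x ≟ i ⟧ (walk-arcs-out w i)

  -- The head of the first arc is the source of the remaining walk, so adding the source makes the
  -- count exact and the induction immediate.
  walk-arcs-in : ∀ {a b xs} (w : Walk a b xs) i → ⟦ a ≟ i ⟧ + cnt proj₂ (walk-arcs w) i ≡ cnt cl xs i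
  walk-arcs-in (visit x)         i = refl
  walk-arcs-in (x ∷⟨ _ ⟩ w) i = cong (⟦ cl x ≟ i ⟧ +_) (walk-arcs-in w i)

  walks-realisable : ∀ ws → Realisable (length ws) (cnt cl (allVisits ws))
  walks-realisable ws = record
    { arcs  = all-arcs ws
    ; valid = valid′ ws
    ; out≤  = λ i → bound proj₁ i (λ w → walk-arcs-out w i) ws
    ; in≤   = λ i → bound proj₂ i (λ w → m+n≤o⇒n≤o ⟦ _ ≟ i ⟧ (≤-reflexive (walk-arcs-in w i))) ws
    } , ≡-trans (size ws) (sym (total-cnt-1 cl (allVisits ws)))
    where
    all-arcs : List OpenWalk → List Arc
    all-arcs = concatMap (walk-arcs ∘ walk)
    valid′ : ∀ ws → All IsArc (all-arcs ws)
    valid′ []       = []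
    valid′ (w ∷ ws) = Allₚ.++⁺ (walk-arcs-valid (walk w)) (valid′ ws)
    bound : ∀ (h : Arc → V) i → (∀ {a b xs} (w : Walk a b xs) → cnt h (walk-arcs w) i ≤ cnt cl xs i) →
            ∀ ws → cnt h (all-arcs ws) i ≤ cnt cl (allVisits ws) i
    bound h i le []       = z≤n
    bound h i le (w ∷ ws)
      rewrite sumOver-++ (λ e → ⟦ h e ≟ i ⟧) (walk-arcs (walk w)) (all-arcs ws)
            | sumOver-++ (λ x → ⟦ cl x ≟ i ⟧) (visits w) (allVisits ws)
      = +-mono-≤ (le (walk w)) (bound h i le ws)
    size : ∀ ws → length (all-arcs ws) + length ws ≡ length (allVisits ws)
    size []       = refl
    size (w ∷ ws)
      rewrite length-++ (walk-arcs (walk w)) {all-arcs ws} | length-++ (visits w) {allVisits ws}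
            | sym (walk-arcs-length (walk w)) | sym (size ws)
      = rearrange (length (walk-arcs (walk w))) _ _
      where
      rearrange : ∀ p q r → p + q + suc r ≡ suc (p + (q + r))
      rearrange = solve-∀

-- Families of pieces inside one factor.

module Pieces (D : Digraph) where

  open Digraph D

  -- Distinctness is left to `allPoints` of a whole family, where it makes the pieces paths and
  -- pairwise disjoint at once.
  record Piece : Set where
    constructor piece
    field
      {first}  : Vertex
      {others} : List Vertex
      linked   : Linked _⟶_ (first ∷ others)

  open Piece public

  points : Piece → List Vertex
  points p = first p ∷ others p

  allPoints : List Piece → List Vertex
  allPoints = concatMap points

  length≤points : ∀ ps → length ps ≤ length (allPoints ps)
  length≤points []       = z≤n
  length≤points (p ∷ ps) = s≤s (≤-trans (length≤points ps)
    (≤-trans (m≤n+m _ (length (others p))) (≤-reflexive (sym (length-++ (others p))))))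

  private
    split-piece : ∀ ps → length (allPoints ps) ≡ length ps ⊎
                  ∃[ ps′ ] (length ps′ ≡ suc (length ps) × allPoints ps′ ≡ allPoints ps)
    split-piece [] = inj₁ refl
    split-piece (piece {x} {y ∷ _} (_ ∷ l) ∷ ps) = inj₂ (piece {x} [-] ∷ piece l ∷ ps , refl , refl)
    split-piece (p@(piece {x} {[]} [-]) ∷ ps) with split-piece ps
    ... | inj₁ eq              = inj₁ (cong suc eq)
    ... | inj₂ (ps′ , len , eq) = inj₂ (p ∷ ps′ , cong suc len , cong (x ∷_) eq)

    open DecMembership _≟_ using (_∈?_)

    -- If no piece can be split, all are single vertices, so fewer than `order` vertices are covered
    -- and a missed one becomes a new piece.
    one-more : ∀ ps → Unique (allPoints ps) → length ps < order →
               ∃[ ps′ ] (length ps′ ≡ suc (length ps) × Unique (allPoints ps′) ×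
                         length (allPoints ps) ≤ length (allPoints ps′))
    one-more ps u small with split-piece ps
    ... | inj₂ (ps′ , len , eq) = ps′ , len , subst Unique (sym eq) u , ≤-reflexive (cong length (sym eq))
    ... | inj₁ eq with any? (λ v → ¬? (v ∈? allPoints ps)) vertices
    ...   | yes p = let v , _ , v∉ = find p
                    in piece {v} [-] ∷ ps , refl , Allₚ.¬Any⇒All¬ _ v∉ ∷ u , n≤1+n _
    ...   | no ¬p = contradiction (≤-trans (Unique-⊆⇒length≤ unique all∈) (≤-reflexive eq)) (<⇒≱ small)
      where
      all∈ : ∀ {v} → v ∈ vertices → v ∈ allPoints ps
      all∈ {v} v∈ with v ∈? allPoints ps
      ... | yes v∈ps = v∈ps
      ... | no  v∉ps = contradiction (lose v∈ v∉ps) ¬p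

  pad : ∀ ps n → Unique (allPoints ps) → length ps ≤ n → n ≤ order →
        ∃[ ps′ ] (length ps′ ≡ n × Unique (allPoints ps′) × length (allPoints ps) ≤ length (allPoints ps′))
  pad ps n u ≤n n≤ = let d , eq = m≤n⇒∃[o]m+o≡n ≤n in go d ps u eq
    where
    go : ∀ d ps → Unique (allPoints ps) → length ps + d ≡ n →
         ∃[ ps′ ] (length ps′ ≡ n × Unique (allPoints ps′) × length (allPoints ps) ≤ length (allPoints ps′))
    go zero    ps u eq = ps , ≡-trans (sym (+-identityʳ _)) eq , u , ≤-refl
    go (suc d) ps u eq =
      let eq′ = ≡-trans (sym (+-suc (length ps) d)) eq
          ps₁ , len₁ , u₁ , le₁ = one-more ps u (≤-trans (s≤s (m≤m+n _ d)) (≤-trans (≤-reflexive eq′) n≤))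
          ps₂ , len₂ , u₂ , le₂ = go d ps₁ u₁ (≡-trans (cong (_+ d) len₁) eq′)
      in ps₂ , len₂ , u₂ , ≤-trans le₁ le₂

-- Paths of the composition as walks through blocks.

module Blocks (T : Digraph) (H : Digraph.Vertex T → Digraph) (semicomplete : Semicomplete T) where

  open Digraph T renaming (Vertex to V; vertices to vs)
  open Composition T H using (CVertex; CArc; inner; outer; fibre)
  open Counting T
  open Transport T semicomplete
  open Pieces using (Piece; piece; points; allPoints)

  Q : Digraph
  Q = T [ H ]

  Block : Set
  Block = Σ V λ i → Piece (H i)

  index : Block → V
  index = proj₁

  block : ∀ i → Piece (H i) → Block
  block i p = i , p

  open Walks T semicomplete Block index public

  blockVerts : Block → List CVertex
  blockVerts (i , p) = map (i ,_) (points (H i) p)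

  walkVerts : OpenWalk → List CVertex
  walkVerts w = concatMap blockVerts (visits w)

  -- A walk depends on a label only through its index, so the first piece may be lengthened freely.
  replace-head : ∀ {i p p′ a b bs} → Walk a b ((i , p) ∷ bs) → Walk a b ((i , p′) ∷ bs)
  replace-head (visit _)       = visit _
  replace-head (_ ∷⟨ ab ⟩ w) = _ ∷⟨ ab ⟩ w

  private
    -- An inner arc lengthens the first piece; an outer arc begins a new piece and becomes an arc of
    -- the walk.
    segment : ∀ i x ys → Linked CArc ((i , x) ∷ ys) →
              ∃[ xs ] Σ (Linked (Digraph._⟶_ (H i)) (x ∷ xs)) λ l → ∃[ b ] ∃[ bs ]
                (Walk i b ((i , piece l) ∷ bs) × concatMap blockVerts ((i , piece l) ∷ bs) ≡ (i , x) ∷ ys)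
    segment i x [] [-] = [] , [-] , i , [] , visit _ , refl
    segment i x ((.i , y) ∷ ys) (inner xy ∷ l) with segment i y ys l
    ... | xs , m , b , bs , w , eq = y ∷ xs , xy ∷ m , b , bs , replace-head w , cong ((i , x) ∷_) eq
    segment i x ((j , y) ∷ ys) (outer ij ∷ l) with segment j y ys l
    ... | xs , m , b , bs , w , eq = [] , [-] , b , _ , _ ∷⟨ ij ⟩ w , cong ((i , x) ∷_) eq

  decompose : ∀ (p : Path Q) → ∃[ w ] walkVerts w ≡ Path.verts p
  decompose record { verts = [] ; nonempty = ne } = contradiction refl ne
  decompose record { verts = (i , x) ∷ ys ; linked = l } =
    let _ , _ , _ , _ , w , eq = segment i x ys l in open-walk w , eq

  private
    -- An arc of `T` joins all vertices of one factor to all of the other, so it does not matter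
    -- where the piece ends or which vertex of the next factor `v` is.
    piece-linked : ∀ {i x xs b v vs} → Linked (Digraph._⟶_ (H i)) (x ∷ xs) → i ⟶ b → proj₁ v ≡ b →
                   Linked CArc (v ∷ vs) → Linked CArc (map (i ,_) (x ∷ xs) ++ v ∷ vs)
    piece-linked [-]      ib refl l = outer ib ∷ l
    piece-linked (xy ∷ m) ib eq   l = inner xy ∷ piece-linked m ib eq l

    walk-linked : ∀ {a b bs} → Walk a b bs →
                  ∃[ v ] ∃[ ys ] (concatMap blockVerts bs ≡ v ∷ ys × proj₁ v ≡ a × Linked CArc (v ∷ ys))
    walk-linked (visit (i , p)) = _ , _ , ++-identityʳ _ , refl , single (Pieces.linked p)
      where
      single : ∀ {x xs} → Linked (Digraph._⟶_ (H i)) (x ∷ xs) → Linked CArc (map (i ,_) (x ∷ xs))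
      single [-]      = [-]
      single (xy ∷ m) = inner xy ∷ single m
    walk-linked ((i , p) ∷⟨ ib ⟩ w) with walk-linked w
    ... | v , ys , eq , at , l =
      _ , _ , cong (blockVerts (i , p) ++_) eq , refl , piece-linked (Pieces.linked p) ib at l

  -- Distinctness of all points together gives both distinctness within each path and disjointness
  -- of the paths.
  assemble : ∀ {k} ws → length ws ≡ k → Unique (concatMap blockVerts (allVisits ws)) →
             ∃[ P ] (∀ {v} → v ∈ concatMap blockVerts (allVisits ws) → Covers {k} {Q} P v)
  assemble ws refl u = record
    { path = λ a → record
        { verts    = walkVerts (lookup ws a)
        ; nonempty = λ eq → let _ , _ , eq′ , _ = walk-linked (walk (lookup ws a))
                            in contradiction (≡-trans (sym eq) eq′) λ ()
        ; linked   = let _ , _ , eq′ , _ , l = walk-linked (walk (lookup ws a)) in subst (Linked CArc) (sym eq′) l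
        ; distinct = Unique-concatMap⁻ walkVerts ws u′ a
        }
    ; disjoint = Disjoint-concatMap⁻ walkVerts ws u′
    } , λ v∈ → ∈-concatMap⇒lookup walkVerts ws (subst (_ ∈_) flat v∈)
    where
    flat : concatMap blockVerts (allVisits ws) ≡ concatMap walkVerts ws
    flat = concatMap-concatMap blockVerts visits ws
    u′ = subst Unique flat u

  piecesIn : ∀ i → List Block → List (Piece (H i))
  piecesIn i [] = []
  piecesIn i ((j , p) ∷ bs) with j ≟ i
  ... | yes refl = p ∷ piecesIn i bs
  ... | no  _    = piecesIn i bs

  length-piecesIn : ∀ i bs → length (piecesIn i bs) ≡ cnt index bs i
  length-piecesIn i [] = refl
  length-piecesIn i ((j , p) ∷ bs) with j ≟ i
  ... | yes refl = cong suc (length-piecesIn i bs)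
  ... | no  _    = length-piecesIn i bs

  ∈-piecesIn⁻ : ∀ i bs {x} → x ∈ allPoints (H i) (piecesIn i bs) → (i , x) ∈ concatMap blockVerts bs
  ∈-piecesIn⁻ i ((j , p) ∷ bs) x∈ with j ≟ i
  ... | no  _    = ∈-++⁺ʳ (blockVerts (j , p)) (∈-piecesIn⁻ i bs x∈)
  ... | yes refl with ∈-++⁻ (points (H i) p) x∈
  ...   | inj₁ x∈p  = ∈-++⁺ˡ (∈-map⁺ (i ,_) x∈p)
  ...   | inj₂ x∈bs = ∈-++⁺ʳ (blockVerts (i , p)) (∈-piecesIn⁻ i bs x∈bs)

  ∈-piecesIn⁺ : ∀ i bs {x} → (i , x) ∈ concatMap blockVerts bs → x ∈ allPoints (H i) (piecesIn i bs)
  ∈-piecesIn⁺ i ((j , p) ∷ bs) x∈ with ∈-++⁻ (blockVerts (j , p)) x∈ | j ≟ i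
  ... | inj₂ x∈bs | no  _    = ∈-piecesIn⁺ i bs x∈bs
  ... | inj₂ x∈bs | yes refl = ∈-++⁺ʳ (points (H i) p) (∈-piecesIn⁺ i bs x∈bs)
  ... | inj₁ x∈p  | j≟i with ∈-map⁻ (j ,_) x∈p | j≟i
  ...   | y , y∈ , refl | yes refl = ∈-++⁺ˡ y∈
  ...   | y , y∈ , refl | no  j≢j  = contradiction refl j≢j

  Unique-piecesIn : ∀ i bs → Unique (concatMap blockVerts bs) → Unique (allPoints (H i) (piecesIn i bs))
  Unique-piecesIn i [] u = []
  Unique-piecesIn i ((j , p) ∷ bs) u with Unique-++⁻ (blockVerts (j , p)) u | j ≟ i
  ... | _  , u₂ , _    | no  _    = Unique-piecesIn i bs u₂
  ... | u₁ , u₂ , disj | yes refl =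
    Uniqueₚ.++⁺ (Uniqueₚ.map⁻ u₁) (Unique-piecesIn i bs u₂)
      (λ (x∈p , x∈bs) → disj (∈-map⁺ (i ,_) x∈p , ∈-piecesIn⁻ i bs x∈bs))

  module FromPaths {k} (P : PathSubdigraph k Q) where

    open PathSubdigraph P

    private
      ws : List OpenWalk
      ws = tabulate (λ a → proj₁ (decompose (path a)))

    blocks : List Block
    blocks = allVisits ws

    blocks-realisable : Realisable k (cnt index blocks)
    blocks-realisable = subst (λ l → Realisable l (cnt index blocks)) (length-tabulate (λ a → proj₁ (decompose (path a))))
                              (walks-realisable ws)

    private
      flat : concatMap blockVerts blocks ≡ concat (tabulate (Path.verts ∘ path))
      flat = ≡-trans (concatMap-concatMap blockVerts visits ws) (cong concat (go path))
        where
        go : ∀ {n} (q : Fin n → Path Q) →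
             map walkVerts (tabulate (λ a → proj₁ (decompose (q a)))) ≡ tabulate (Path.verts ∘ q)
        go {zero}  q = refl
        go {suc n} q = cong₂ _∷_ (proj₂ (decompose (q zero))) (go (q ∘ suc))

    blocks-unique : Unique (concatMap blockVerts blocks)
    blocks-unique = subst Unique (sym flat)
      (Uniqueₚ.concat⁺ (Allₚ.tabulate⁺ (Path.distinct ∘ path)) (AllPairsₚ.tabulate⁺ disjoint))

    covered⇒∈blocks : ∀ {v} → Covers P v → v ∈ concatMap blockVerts blocks
    covered⇒∈blocks (a , v∈) = subst (_ ∈_) (sym flat) (∈-concat⁺′ v∈ (∈-tabulate⁺ a))

    #coveredIn≤ : ∀ i → #coveredIn {T} {H} i P ≤ length (allPoints (H i) (piecesIn i blocks))
    #coveredIn≤ i = Unique-⊆⇒length≤ (Uniqueₚ.filter⁺ (λ x → covers? P (i , x)) (Digraph.unique (H i)))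
      (λ x∈ → ∈-piecesIn⁺ i blocks (covered⇒∈blocks (proj₂ (∈-filter⁻ (λ x → covers? P (i , x)) {xs = Digraph.vertices (H i)} x∈))))

  blocksOf : (∀ i → List (Piece (H i))) → List Block
  blocksOf B = concatMap (λ i → map (block i) (B i)) vs

  cnt-blocksOf : ∀ B i → cnt index (blocksOf B) i ≡ length (B i)
  cnt-blocksOf B i = go unique (complete i)
    where
    same : ∀ j (ps : List (Piece (H j))) → j ≡ i → cnt index (map (block j) ps) i ≡ length ps
    same j []       _    = refl
    same j (p ∷ ps) refl = cong₂ _+_ (⟦⟧-yes (j ≟ j) refl) (same j ps refl)
    other : ∀ j (ps : List (Piece (H j))) → j ≢ i → cnt index (map (block j) ps) i ≡ 0
    other j []       _   = refl
    other j (p ∷ ps) j≢i = cong₂ _+_ (⟦⟧-no (j ≟ i) j≢i) (other j ps j≢i)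
    step : ∀ j js → cnt index (concatMap (λ i → map (block i) (B i)) (j ∷ js)) i ≡
                    cnt index (map (block j) (B j)) i + cnt index (concatMap (λ i → map (block i) (B i)) js) i
    step j js = sumOver-++ (λ b → ⟦ index b ≟ i ⟧) (map (block j) (B j)) _
    none : ∀ js → All (i ≢_) js → cnt index (concatMap (λ i → map (block i) (B i)) js) i ≡ 0
    none []       []          = refl
    none (j ∷ js) (i≢j ∷ i≢) = ≡-trans (step j js) (cong₂ _+_ (other j (B j) (i≢j ∘ sym)) (none js i≢))
    go : ∀ {js} → Unique js → i ∈ js → cnt index (concatMap (λ i → map (block i) (B i)) js) i ≡ length (B i)
    go {j ∷ js} (j≢ ∷ _) (here refl) =
      ≡-trans (step j js) (≡-trans (cong₂ _+_ (same j (B j) refl) (none js j≢)) (+-identityʳ _))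
    go {j ∷ js} (j≢ ∷ u) (there i∈)  =
      ≡-trans (step j js) (cong₂ _+_ (other j (B j) (All.lookup j≢ i∈)) (go u i∈))

  private
    blocksOf-verts : ∀ B → concatMap blockVerts (blocksOf B) ≡ concatMap (λ i → map (i ,_) (allPoints (H i) (B i))) vs
    blocksOf-verts B = ≡-trans (concatMap-concatMap blockVerts (λ i → map (block i) (B i)) vs)
                               (cong concat (go vs))
      where
      go : ∀ js → map (λ i → concatMap blockVerts (map (block i) (B i))) js ≡ map (λ i → map (i ,_) (allPoints (H i) (B i))) js
      go []       = refl
      go (j ∷ js) = cong₂ _∷_ (≡-trans (concatMap-map blockVerts (block j) (B j)) (sym (map-concatMap (j ,_) (points (H j)) (B j)))) (go js)

  blocksOf-unique : ∀ B → (∀ i → Unique (allPoints (H i) (B i))) → Unique (concatMap blockVerts (blocksOf B))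
  blocksOf-unique B u = subst Unique (sym (blocksOf-verts B)) (Uniqueₚ.concat⁺
    (Allₚ.map⁺ (All.tabulate (λ {i} _ → Uniqueₚ.map⁺ (λ { refl → refl }) (u i))))
    (AllPairsₚ.map⁺ (AllPairs.map apart unique)))
    where
    apart : ∀ {i j} → i ≢ j → Disjoint (map (i ,_) (allPoints (H i) (B i))) (map (j ,_) (allPoints (H j) (B j)))
    apart i≢j (v∈i , v∈j) with ∈-map⁻ _ v∈i | ∈-map⁻ _ v∈j
    ... | _ , _ , refl | _ , _ , refl = i≢j refl

  ∈-blocksOf : ∀ B {i x} → x ∈ allPoints (H i) (B i) → (i , x) ∈ concatMap blockVerts (blocksOf B)
  ∈-blocksOf B {i} x∈ = subst (_ ∈_) (sym (blocksOf-verts B))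
    (∈-concat⁺′ (∈-map⁺ (i ,_) x∈) (∈-map⁺ (λ i → map (i ,_) (allPoints (H i) (B i))) (complete i)))

  #covered≡total : ∀ {k} (P : PathSubdigraph k Q) → #covered P ≡ total (λ i → #coveredIn {T} {H} i P)
  #covered≡total P = go vs
    where
    go : ∀ js → length (filter (covers? P) (concat (map fibre js))) ≡ sumOver (λ i → #coveredIn {T} {H} i P) js
    go []       = refl
    go (j ∷ js) = ≡-trans (cong length (filter-++ (covers? P) (fibre j) _))
      (≡-trans (length-++ (filter (covers? P) (fibre j)))
        (cong₂ _+_ (length-filter-map (covers? P) (j ,_) (Digraph.vertices (H j))) (go js)))

  -- One path subdigraph good in all factors.

  module Simultaneous {k} (1≤k : 1 ≤ k) (v : V) (P : V → PathSubdigraph k Q) where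

    private
      module FP j = FromPaths (P j)

      -- The head `i` only supplies the nonempty list that `argmax` expects.
      best : ∀ i → ∃[ m ] (∀ {j} → j ∈ i ∷ vs → cnt index (FP.blocks j) i ≤ cnt index (FP.blocks m) i)
      best i = argmax (λ j → cnt index (FP.blocks j) i) i vs

      -- The maximum may come from a member of the family other than `P i`.
      N : V → ℕ
      N i = cnt index (FP.blocks (proj₁ (best i))) i

      ≤N : ∀ i j → cnt index (FP.blocks j) i ≤ N i
      ≤N i j = proj₂ (best i) (there (complete j))

      N≤order : ∀ i → N i ≤ Digraph.order (H i)
      N≤order i = begin
        N i                                        ≡⟨ length-piecesIn i bs ⟨
        length (piecesIn i bs)                     ≤⟨ Pieces.length≤points (H i) (piecesIn i bs) ⟩
        length (allPoints (H i) (piecesIn i bs))   ≤⟨ Unique-⊆⇒length≤ (Unique-piecesIn i bs (FP.blocks-unique (proj₁ (best i))))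
                                                        (λ _ → Digraph.complete (H i) _) ⟩
        Digraph.order (H i)                        ∎
        where
        open ≤-Reasoning
        bs = FP.blocks (proj₁ (best i))

      -- The pieces are those of `P i`, whose coverage of `H i` is to be kept; only their number is
      -- raised, to `N i`.
      padded : ∀ i → ∃[ ps ] (length ps ≡ N i × Unique (allPoints (H i) ps) ×
                              length (allPoints (H i) (piecesIn i (FP.blocks i))) ≤ length (allPoints (H i) ps))
      padded i = Pieces.pad (H i) (piecesIn i (FP.blocks i)) (N i) (Unique-piecesIn i (FP.blocks i) (FP.blocks-unique i))
                   (≤-trans (≤-reflexive (length-piecesIn i (FP.blocks i))) (≤N i i)) (N≤order i)

      ps* : ∀ i → List (Piece (H i))
      ps* i = proj₁ (padded i)

      L : List Block
      L = blocksOf ps*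

      L≡N : ∀ i → cnt index L i ≡ N i
      L≡N i = ≡-trans (cnt-blocksOf ps* i) (proj₁ (proj₂ (padded i)))

      L-unique : Unique (concatMap blockVerts L)
      L-unique = blocksOf-unique ps* (λ i → proj₁ (proj₂ (proj₂ (padded i))))

      realisable : Realisable k (cnt index L)
      realisable = realisable-join k (cnt index L) v λ u →
        let m = proj₁ (best u)
        in cnt index (FP.blocks m) , FP.blocks-realisable m ,
           (λ i → ≤-trans (≤N i m) (≤-reflexive (sym (L≡N i)))) , sym (L≡N u)

    -- Blocks taken from different members of the family can be combined, since walks see only their
    -- indices and the vector `N` of these is realisable.
    simultaneous : ∃[ P* ] (∀ i → #coveredIn {T} {H} i (P i) ≤ #coveredIn {T} {H} {k} i P*)
    simultaneous =
      let ws , len , p = walks-through 1≤k L realisable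
          verts↭ = concatMap-↭ blockVerts (↭-sym p)
          P* , covers = assemble ws len (Unique-resp-↭ verts↭ L-unique)
      in P* , bound P* (covers ∘ ∈-resp-↭ verts↭)
      where
      open ≤-Reasoning
      bound : ∀ P* → (∀ {x} → x ∈ concatMap blockVerts L → Covers {k} {Q} P* x) →
              ∀ i → #coveredIn {T} {H} i (P i) ≤ #coveredIn {T} {H} i P*
      bound P* covers i = begin
        #coveredIn {T} {H} i (P i)                           ≤⟨ FP.#coveredIn≤ i i ⟩
        length (allPoints (H i) (piecesIn i (FP.blocks i)))  ≤⟨ proj₂ (proj₂ (proj₂ (padded i))) ⟩
        length (allPoints (H i) (ps* i))                     ≤⟨ Unique-⊆⇒length≤ (proj₁ (proj₂ (proj₂ (padded i))))
                                                                  (λ x∈ → ∈-filter⁺ (λ x → covers? P* (i , x))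
                                                                    (Digraph.complete (H i) _) (covers (∈-blocksOf ps* x∈))) ⟩
        #coveredIn {T} {H} i P*                              ∎

open Digraph using (Vertex; order)

-- `P*` covers at least `ℓ j` vertices in every `H j`, so by maximality `P` covers at least the sum
-- of all `ℓ j`. It covers at most `ℓ j` in each `H j`, so equality holds throughout.
theorem3p7 : (T : Digraph) (H : Vertex T → Digraph) →
    2 ≤ order T →
    (∀ i → 1 ≤ order (H i)) →
    Semicomplete T →
    Strong (T [ H ]) →
    (k : ℕ) → 1 ≤ k → k ≤ order (T [ H ]) →
    (ℓ : Vertex T → ℕ) →
    (∀ i → IsMaximumValue (#coveredIn {T} {H} {k} i) (ℓ i)) →
    (P : PathSubdigraph k (T [ H ])) → IsMaximum P →
    ∀ i → #coveredIn {T} {H} i P ≡ ℓ i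
theorem3p7 T H _ _ semicomplete _ k 1≤k _ ℓ ℓ-max P P-max i =
  sumOver-squeeze vs (λ j → proj₂ (ℓ-max j) P) (Σℓ≤ΣP simultaneous) (Digraph.complete T i)
  where
  open Blocks T H semicomplete using (#covered≡total; module Simultaneous)
  -- The family takes for each `j` a witness attaining `ℓ j`; `i` serves as a vertex of `T`.
  open Simultaneous 1≤k i (λ j → proj₁ (proj₁ (ℓ-max j))) using (simultaneous)
  open ≤-Reasoning
  vs = Digraph.vertices T
  Σℓ≤ΣP : ∃[ P* ] (∀ j → #coveredIn {T} {H} j (proj₁ (proj₁ (ℓ-max j))) ≤ #coveredIn {T} {H} {k} j P*) →
          sumOver ℓ vs ≤ sumOver (λ j → #coveredIn {T} {H} j P) vs
  Σℓ≤ΣP (P* , P*-large) = begin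
    sumOver ℓ vs
      ≤⟨ sumOver-mono vs (λ {j} _ → subst (_≤ #coveredIn {T} {H} j P*) (proj₂ (proj₁ (ℓ-max j))) (P*-large j)) ⟩
    sumOver (λ j → #coveredIn {T} {H} j P*) vs  ≡⟨ #covered≡total P* ⟨
    #covered P*                                 ≤⟨ P-max P* ⟩
    #covered P                                  ≡⟨ #covered≡total P ⟩
    sumOver (λ j → #coveredIn {T} {H} j P) vs   ∎
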